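{- Let $n\ge 4$ be even. Let the multiplicative group $\Gamma=\mathbb R_{>0}^n$ act on $\mathbb R_{>0}^{E_n}$ by $\lambda\cdot x=(\lambda_i\lambda_j x_{\{i,j\}})_{\{i,j\}\in E_n}$ for $\lambda\in\Gamma$, $x\in\mathbb R_{>0}^{E_n}$. Then every $\Gamma$-invariant subset of $\mathbb R_{>0}^{E_n}$ is fiber-invariant for the map $\varphi:\mathbb R_{>0}^{E_n}\to\mathbb R_{>0}^{\mathcal M_n}$, $\varphi(x)=(x_M)_{M\in\mathcal M_n}$, where $x_M=\prod_{e\in M}x_e$.
   Context: $E_n$ denotes the set of edges of the complete graph on vertex set $[n]=\{1,\dots,n\}$ (i.e. the 2-element subsets of $[n]$), and $\mathcal M_n$ denotes the set of perfect matchings of this complete graph. For a map $f:X\to Y$, a subset $D\subseteq X$ is fiber-invariant for $f$ if for every $y\in f(D)$ the whole fiber $f^{ -1}(y)$ is contained in $D$. -}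

module Defs where

open import Data.Bool.Base using (Bool; T)
open import Data.Fin.Base as Fin using (Fin)
import Data.Fin.Properties as Fin
open import Data.Integer.Base as ℤ using (+_; -[1+_])
import Data.Integer.Properties as ℤ
open import Data.List.Base using (List; []; _∷_; allFin; cartesianProduct; filterᵇ; foldr; map; mapMaybe)
open import Data.Maybe.Base using (Maybe; just; nothing)
open import Data.Nat.Base as ℕ using (ℕ; zero; suc)
import Data.Nat.Properties as ℕ
open import Data.Product.Base using (Σ; ∃; ∃₂; _×_; _,_; proj₁; proj₂; uncurry)
open import Data.Product using (∃!)
open import Data.Rational.Base using (ℚ; 0ℚ; 1ℚ; ½; _+_; _*_; -_; _-_; 1/_; _<_; _≤_; *<*; mkℚ; toℚᵘ; positive; Positive; NonZero)
open import Data.Rational.Properties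
open import Data.Rational.Solver using (module +-*-Solver)
import Data.Rational.Unnormalised.Base as ℚᵘ
import Data.Rational.Unnormalised.Properties as ℚᵘ
open import Data.Sum.Base using (_⊎_; inj₁; inj₂)
open import Function.Bundles using (Func)
open import Level using (Level; 0ℓ; _⊔_) renaming (suc to lsuc)
open import Relation.Binary.Bundles using (Setoid)
open import Relation.Binary.Definitions using (tri<; tri≈; tri>)
open import Relation.Binary.PropositionalEquality using (_≡_; refl; sym; trans; cong; subst; subst₂)
open import Relation.Nullary.Decidable.Core using (yes; no)
open import Relation.Nullary.Negation.Core using (¬_; contradiction)
open import Relation.Unary using (Pred; _∈_; _⊆_; _≐_)
open import Relation.Unary.Properties using (≐-refl; ≐-sym; ≐-trans)

private variable
  a b ℓ ℓ₁ ℓ₂ : Level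

-- Dedekind reals: two-sided, rounded, located cuts of ℚ, identified when the
-- cuts have the same elements.  Two-sidedness and locatedness make this the
-- usual constructive definition.

record ℝ : Set₁ where
  field
    lower : Pred ℚ 0ℓ
    upper : Pred ℚ 0ℓ
    lower-inhabited : ∃ λ q → q ∈ lower
    upper-inhabited : ∃ λ q → q ∈ upper
    lower-closed    : ∀ {q r} → q < r → r ∈ lower → q ∈ lower
    upper-closed    : ∀ {q r} → q < r → q ∈ upper → r ∈ upper
    lower-open      : ∀ {q} → q ∈ lower → ∃ λ r → q < r × r ∈ lower
    upper-open      : ∀ {r} → r ∈ upper → ∃ λ q → q < r × q ∈ upper
    disjoint        : ∀ {q} → q ∈ lower → ¬ q ∈ upper
    located         : ∀ {q r} → q < r → q ∈ lower ⊎ r ∈ upper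

open ℝ public

infix 4 _≃_

_≃_ : ℝ → ℝ → Set
x ≃ y = lower x ≐ lower y × upper x ≐ upper y

IsPositive : ℝ → Set
IsPositive x = 0ℚ ∈ lower x

ℝ>0 : Set₁
ℝ>0 = Σ ℝ IsPositive

ℝ>0-setoid : Setoid (lsuc 0ℓ) 0ℓ
ℝ>0-setoid = record
  { Carrier = ℝ>0
  ; _≈_ = λ x y → proj₁ x ≃ proj₁ y
  ; isEquivalence = record
    { refl  = ≐-refl , ≐-refl
    ; sym   = λ (p , q) → ≐-sym p , ≐-sym q
    ; trans = λ (p , q) (p′ , q′) → ≐-trans p p′ , ≐-trans q q′
    }
  }

private
  ι : ℕ → ℚ
  ι zero    = 0ℚ
  ι (suc k) = 1ℚ + ι k

  toℚᵘ-ι : ∀ k → toℚᵘ (ι k) ℚᵘ.≃ ℚᵘ.mkℚᵘ (+ k) 0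
  toℚᵘ-ι zero    = ℚᵘ.≃-refl
  toℚᵘ-ι (suc k) = ℚᵘ.≃-trans (toℚᵘ-homo-+ 1ℚ (ι k))
    (ℚᵘ.≃-trans (ℚᵘ.+-congʳ ℚᵘ.1ℚᵘ (toℚᵘ-ι k))
      (ℚᵘ.*≡* (cong (λ m → (+ 1 ℤ.+ m) ℤ.* + 1) (ℤ.*-identityʳ (+ k)))))

private abstract
  archimedean : ∀ c → ∃ λ k → c < ι k
  archimedean c@(mkℚ (+ m) d _) = suc m , toℚᵘ-cancel-<
    (ℚᵘ.<-respʳ-≃ (ℚᵘ.≃-sym (toℚᵘ-ι (suc m))) (ℚᵘ.*<* lem))
    where
    lem : + m ℤ.* + 1 ℤ.< + suc m ℤ.* + suc d
    lem = subst₂ ℤ._<_ (sym (ℤ.*-identityʳ (+ m))) (ℤ.pos-* (suc m) (suc d))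
            (ℤ.+<+ (ℕ.m≤m*n (suc m) (suc d)))
  archimedean c@(mkℚ -[1+ m ] d _) = 0 , *<* ℤ.-<+

  0<1 : 0ℚ < 1ℚ
  0<1 = *<* (ℤ.+<+ (ℕ.s≤s ℕ.z≤n))

  0<p*q : ∀ {p q} → 0ℚ < p → 0ℚ < q → 0ℚ < p * q
  0<p*q {p} {q} 0<p 0<q =
    subst (_< p * q) (*-zeroʳ p) (*-monoʳ-<-pos p {{positive 0<p}} 0<q)

  *-mono-< : ∀ {p q r s} → 0ℚ < p → p < q → 0ℚ < r → r < s → p * r < q * s
  *-mono-< {p} {q} {r} {s} 0<p p<q 0<r r<s = <-trans
    (*-monoˡ-<-pos r {{positive 0<r}} p<q)
    (*-monoʳ-<-pos q {{positive (<-trans 0<p p<q)}} r<s)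

  p<p+q : ∀ p {q} → 0ℚ < q → p < p + q
  p<p+q p {q} 0<q = subst (_< p + q) (+-identityʳ p) (+-monoʳ-< p 0<q)

  inverse : ∀ {p} → 0ℚ < p → ∃ λ w → 0ℚ < w × p * w ≡ 1ℚ
  inverse {p} 0<p = (1/ p) , positive⁻¹ (1/ p) {{1/pos⇒pos p}} , *-inverseʳ p
    where instance
      p-pos : Positive p
      p-pos = positive 0<p
      p-nonZero : NonZero p
      p-nonZero = pos⇒nonZero p

  q<r⇒0<r-q : ∀ {q r} → q < r → 0ℚ < r - q
  q<r⇒0<r-q {q} {r} q<r = subst (_< r - q) (+-inverseʳ q) (+-monoˡ-< (- q) q<r)

abstract
  lower<upper : ∀ x {q r} → q ∈ lower x → r ∈ upper x → q < r
  lower<upper x {q} {r} q∈ r∈ with <-cmp q r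
  ... | tri< q<r _ _ = q<r
  ... | tri≈ _ refl _ = contradiction r∈ (disjoint x q∈)
  ... | tri> _ _ r<q = contradiction (upper-closed x r<q r∈) (disjoint x q∈)

private
  walk : ∀ x {δ} → 0ℚ < δ → ∀ k {p} → p ∈ lower x → p + ι k * δ ∈ upper x →
         ∃ λ q → p ≤ q × q ∈ lower x × (q + δ) + δ ∈ upper x
  walk x {δ} 0<δ zero {p} p∈ u∈ = contradiction
    (subst (upper x) (trans (cong (_+_ p) (*-zeroˡ δ)) (+-identityʳ p)) u∈)
    (disjoint x p∈)
  walk x {δ} 0<δ (suc k) {p} p∈ u∈ with located x (p<p+q (p + δ) 0<δ)
  ... | inj₂ u = p , ≤-refl , p∈ , u
  ... | inj₁ l =
    let q , p+δ≤q , q∈ , u = walk x 0<δ k l (subst (upper x) (eq p (ι k) δ) u∈)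
    in q , ≤-trans (<⇒≤ (p<p+q p 0<δ)) p+δ≤q , q∈ , u
    where
    open +-*-Solver
    eq : ∀ p i δ → p + (1ℚ + i) * δ ≡ (p + δ) + i * δ
    eq = solve 3 (λ p i δ → p :+ (con 1ℚ :+ i) :* δ := (p :+ δ) :+ i :* δ) refl

private abstract
  q+[r-q]≡r : ∀ q r → q + (r - q) ≡ r
  q+[r-q]≡r = solve 2 (λ q r → q :+ (r :- q) := r) refl
    where open +-*-Solver

  halve : ∀ {ε} → 0ℚ < ε → ∃ λ δ → 0ℚ < δ × δ + δ ≡ ε
  halve {ε} 0<ε = ½ * ε , 0<p*q {½} {ε} (positive⁻¹ ½) 0<ε ,
    trans (sym (*-distribʳ-+ ε ½ ½)) (*-identityˡ ε)

  rearrange : ∀ c w d → (c * w) * d ≡ c * (d * w)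
  rearrange = solve 3 (λ c w d → (c :* w) :* d := c :* (d :* w)) refl
    where open +-*-Solver

  reach : ∀ {p u w δ} → 0ℚ < δ → δ * w ≡ 1ℚ → ∀ t → (u - p) * w < t → u < p + t * δ
  reach {p} {u} {w} {δ} 0<δ δw≡1 t c<t = subst (_< p + t * δ) (q+[r-q]≡r p u)
    (+-monoʳ-< p (subst (_< t * δ)
      (trans (rearrange (u - p) w δ) (trans (cong ((u - p) *_) δw≡1) (*-identityʳ (u - p))))
      (*-monoˡ-<-pos δ {{positive 0<δ}} c<t)))

  approximate₂ : ∀ x {p δ} → p ∈ lower x → 0ℚ < δ →
                 ∃ λ q → p ≤ q × q ∈ lower x × (q + δ) + δ ∈ upper x
  approximate₂ x {p} {δ} p∈ 0<δ = go (upper-inhabited x) (inverse 0<δ)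
    where
    go′ : ∀ {u w} → u ∈ upper x → δ * w ≡ 1ℚ → (∃ λ k → (u - p) * w < ι k) →
          ∃ λ q → p ≤ q × q ∈ lower x × (q + δ) + δ ∈ upper x
    go′ u∈ δw≡1 (k , c<k) = walk x 0<δ k p∈ (upper-closed x (reach 0<δ δw≡1 (ι k) c<k) u∈)
    go : (∃ λ u → u ∈ upper x) → (∃ λ w → 0ℚ < w × δ * w ≡ 1ℚ) →
         ∃ λ q → p ≤ q × q ∈ lower x × (q + δ) + δ ∈ upper x
    go (u , u∈) (w , _ , δw≡1) = go′ u∈ δw≡1 (archimedean ((u - p) * w))

abstract
  approximate : ∀ x {p ε} → p ∈ lower x → 0ℚ < ε →
                ∃ λ q → p ≤ q × q ∈ lower x × q + ε ∈ upper x
  approximate x {p} {ε} p∈ 0<ε = go (halve 0<ε)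
    where
    go′ : ∀ {δ} → δ + δ ≡ ε → (∃ λ q → p ≤ q × q ∈ lower x × (q + δ) + δ ∈ upper x) →
          ∃ λ q → p ≤ q × q ∈ lower x × q + ε ∈ upper x
    go′ {δ} δ+δ≡ε (q , p≤q , q∈ , v∈) =
      q , p≤q , q∈ , subst (upper x) (trans (+-assoc q δ δ) (cong (_+_ q) δ+δ≡ε)) v∈
    go : (∃ λ δ → 0ℚ < δ × δ + δ ≡ ε) → ∃ λ q → p ≤ q × q ∈ lower x × q + ε ∈ upper x
    go (δ , 0<δ , δ+δ≡ε) = go′ δ+δ≡ε (approximate₂ x p∈ 0<δ)

private abstract
  tolerance : ∀ {K e} → 0ℚ < K → 0ℚ < e → ∃ λ δ → 0ℚ < δ × δ < 1ℚ × K * δ < e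
  tolerance {K} {e} 0<K 0<e = from (inverse (+-mono-< 0<K 0<e))
    where
    open +-*-Solver
    eq : ∀ e K w → e * (K * w) ≡ K * (e * w)
    eq = solve 3 (λ e K w → e :* (K :* w) := K :* (e :* w)) refl
    from : (∃ λ w → 0ℚ < w × (K + e) * w ≡ 1ℚ) → ∃ λ δ → 0ℚ < δ × δ < 1ℚ × K * δ < e
    from (w , 0<w , inv) = e * w , 0<p*q 0<e 0<w ,
      subst (e * w <_) inv (*-monoˡ-<-pos w {{positive 0<w}}
        (subst (_< K + e) (+-identityˡ e) (+-monoˡ-< e 0<K))) ,
      subst₂ _<_ (eq e K w) (*-identityʳ e) (*-monoʳ-<-pos e {{positive 0<e}}
        (subst (K * w <_) inv (*-monoˡ-<-pos w {{positive 0<w}} (p<p+q K 0<e))))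

  product-bound : ∀ {u v e δ p s} → 0ℚ < δ → δ < 1ℚ → ((u + v) + 1ℚ) * δ < e →
                  p < u → s < v → (p + δ) * (s + δ) < p * s + e
  product-bound {u} {v} {e} {δ} {p} {s} 0<δ δ<1 Kδ<e p<u s<v =
    subst (_< p * s + e) (eq p s δ) (+-monoʳ-< (p * s) (<-trans
      (*-monoˡ-<-pos δ {{positive 0<δ}} (+-mono-< (+-mono-< p<u s<v) δ<1)) Kδ<e))
    where
    open +-*-Solver
    eq : ∀ p s δ → p * s + ((p + s) + δ) * δ ≡ (p + δ) * (s + δ)
    eq = solve 3 (λ p s δ → p :* s :+ ((p :+ s) :+ δ) :* δ := (p :+ δ) :* (s :+ δ)) refl

1ℝ>0 : ℝ>0
1ℝ>0 = record
  { lower = _< 1ℚ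
  ; upper = 1ℚ <_
  ; lower-inhabited = 0ℚ , 0<1
  ; upper-inhabited = 1ℚ + 1ℚ , p<p+q 1ℚ 0<1
  ; lower-closed = <-trans
  ; upper-closed = λ q<r 1<q → <-trans 1<q q<r
  ; lower-open = λ q<1 → let r , q<r , r<1 = <-dense q<1 in r , q<r , r<1
  ; upper-open = λ 1<r → let q , 1<q , q<r = <-dense 1<r in q , q<r , 1<q
  ; disjoint = <-asym
  ; located = one-located
  } , 0<1
  where
  one-located : ∀ {q r} → q < r → q < 1ℚ ⊎ 1ℚ < r
  one-located {q} q<r with q <? 1ℚ
  ... | yes q<1 = inj₁ q<1
  ... | no  q≮1 = inj₂ (≤-<-trans (≮⇒≥ q≮1) q<r)

-- For positive factors the lower cut of a product is generated by the products
-- of positive lower bounds; upper bounds of a positive real are positive.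

infixl 7 _*⁺_

_*⁺_ : ℝ>0 → ℝ>0 → ℝ>0
(x , 0<x) *⁺ (y , 0<y) = record
  { lower = L
  ; upper = U
  ; lower-inhabited = 0ℚ , 0∈L
  ; upper-inhabited =
      let u , u∈ = upper-inhabited x ; v , v∈ = upper-inhabited y
      in u * v + 1ℚ , u , v , u∈ , v∈ , p<p+q (u * v) 0<1
  ; lower-closed = λ q<r (p , s , 0<p , 0<s , p∈ , s∈ , r<ps) →
      p , s , 0<p , 0<s , p∈ , s∈ , <-trans q<r r<ps
  ; upper-closed = λ q<r (u , v , u∈ , v∈ , uv<q) → u , v , u∈ , v∈ , <-trans uv<q q<r
  ; lower-open = λ (p , s , 0<p , 0<s , p∈ , s∈ , q<ps) →
      let r , q<r , r<ps = <-dense q<ps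
      in r , q<r , p , s , 0<p , 0<s , p∈ , s∈ , r<ps
  ; upper-open = λ (u , v , u∈ , v∈ , uv<r) →
      let q , uv<q , q<r = <-dense uv<r
      in q , q<r , u , v , u∈ , v∈ , uv<q
  ; disjoint = λ (p , s , 0<p , 0<s , p∈ , s∈ , q<ps) (u , v , u∈ , v∈ , uv<q) →
      <-asym (<-trans uv<q q<ps)
        (*-mono-< 0<p (lower<upper x p∈ u∈) 0<s (lower<upper y s∈ v∈))
  ; located = product-located
  } , 0∈L
  where
  L U : Pred ℚ 0ℓ
  L q = ∃₂ λ p s → 0ℚ < p × 0ℚ < s × p ∈ lower x × s ∈ lower y × q < p * s
  U q = ∃₂ λ u v → u ∈ upper x × v ∈ upper y × u * v < q

  0∈L : L 0ℚ
  0∈L =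
    let p , 0<p , p∈ = lower-open x 0<x ; s , 0<s , s∈ = lower-open y 0<y
    in p , s , 0<p , 0<s , p∈ , s∈ , 0<p*q 0<p 0<s

  product-located : ∀ {q r} → q < r → L q ⊎ U r
  product-located {q} {r} q<r with upper-inhabited x | upper-inhabited y
  ... | u , u∈ | v , v∈ with tolerance
          (+-mono-< (+-mono-< (lower<upper x 0<x u∈) (lower<upper y 0<y v∈)) 0<1)
          (q<r⇒0<r-q q<r)
  ... | δ , 0<δ , δ<1 , Kδ<e with lower-open x 0<x | lower-open y 0<y
  ... | p₀ , 0<p₀ , p₀∈ | s₀ , 0<s₀ , s₀∈ with approximate x p₀∈ 0<δ | approximate y s₀∈ 0<δ
  ... | p , p₀≤p , p∈ , p+δ∈ | s , s₀≤s , s∈ , s+δ∈ with q <? p * s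
  ... | yes q<ps = inj₁
          (p , s , <-≤-trans 0<p₀ p₀≤p , <-≤-trans 0<s₀ s₀≤s , p∈ , s∈ , q<ps)
  ... | no  q≮ps = inj₂ (p + δ , s + δ , p+δ∈ , s+δ∈ , <-≤-trans
          (product-bound 0<δ δ<1 Kδ<e (lower<upper x p∈ u∈) (lower<upper y s∈ v∈))
          (subst (p * s + (r - q) ≤_) (q+[r-q]≡r q r) (+-monoˡ-≤ (r - q) (≮⇒≥ q≮ps))))

open Setoid ℝ>0-setoid using (_≈_) renaming (refl to ≈-refl; sym to ≈-sym; trans to ≈-trans) public

*⁺-cong : ∀ {x x′ y y′} → x ≈ x′ → y ≈ y′ → x *⁺ y ≈ x′ *⁺ y′
*⁺-cong ((l , l′) , (u , u′)) ((m , m′) , (v , v′)) =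
  ((λ (p , s , 0<p , 0<s , p∈ , s∈ , <ps) → p , s , 0<p , 0<s , l p∈ , m s∈ , <ps) ,
   (λ (p , s , 0<p , 0<s , p∈ , s∈ , <ps) → p , s , 0<p , 0<s , l′ p∈ , m′ s∈ , <ps)) ,
  ((λ (p , s , p∈ , s∈ , ps<) → p , s , u p∈ , v s∈ , ps<) ,
   (λ (p , s , p∈ , s∈ , ps<) → p , s , u′ p∈ , v′ s∈ , ps<))

infix 8 ℝ>0^_

ℝ>0^_ : Set a → Setoid (a ⊔ lsuc 0ℓ) a
ℝ>0^ I = record
  { Carrier = I → ℝ>0
  ; _≈_ = λ x y → ∀ i → x i ≈ y i
  ; isEquivalence = record
    { refl  = λ {x} i → ≈-refl {x i}
    ; sym   = λ {x} {y} p i → ≈-sym {x i} {y i} (p i)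
    ; trans = λ {x} {y} {z} p q i → ≈-trans {x i} {y i} {z i} (p i) (q i)
    }
  }

-- A 2-element subset of the vertex set is represented by its elements in
-- increasing order.

record Edge (n : ℕ) : Set where
  constructor edge
  field
    lo hi  : Fin n
    .lo<hi : lo Fin.< hi

open Edge public

Incident : ∀ {n} → Fin n → Edge n → Set
Incident v e = v ≡ lo e ⊎ v ≡ hi e

edge? : ∀ {n} → Fin n → Fin n → Maybe (Edge n)
edge? i j with i Fin.<? j
... | yes i<j = just (edge i j i<j)
... | no  _   = nothing

-- Every edge occurs exactly once in this list.
edges : ∀ n → List (Edge n)
edges n = mapMaybe (uncurry edge?) (cartesianProduct (allFin n) (allFin n))

-- A perfect matching is a set of edges, given by its characteristic function,
-- such that every vertex lies on exactly one of its edges.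
record PerfectMatching (n : ℕ) : Set where
  field
    member       : Edge n → Bool
    covered-once : ∀ v → ∃! _≡_ λ e → T (member e) × Incident v e

open PerfectMatching public

∏ : List ℝ>0 → ℝ>0
∏ = foldr _*⁺_ 1ℝ>0

matchingProduct : ∀ {n} → (Edge n → ℝ>0) → PerfectMatching n → ℝ>0
matchingProduct {n} x M = ∏ (map x (filterᵇ (member M) (edges n)))

φ : ∀ n → Func (ℝ>0^ Edge n) (ℝ>0^ PerfectMatching n)
φ n = record
  { to   = matchingProduct
  ; cong = λ {x} {y} x≈y M → ∏-cong {x} {y} x≈y (filterᵇ (member M) (edges n))
  }
  where
  ∏-cong : ∀ {x y : Edge n → ℝ>0} → (∀ e → x e ≈ y e) → ∀ es → ∏ (map x es) ≈ ∏ (map y es)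
  ∏-cong x≈y [] = ≈-refl {1ℝ>0}
  ∏-cong {x} {y} x≈y (e ∷ es) =
    *⁺-cong {x e} {y e} {∏ (map x es)} {∏ (map y es)} (x≈y e) (∏-cong {x} {y} x≈y es)

infixr 7 _·_

_·_ : ∀ {n} → (Fin n → ℝ>0) → (Edge n → ℝ>0) → (Edge n → ℝ>0)
(λ′ · x) e = λ′ (lo e) *⁺ λ′ (hi e) *⁺ x e

Γ-Invariant : ∀ {n} → Pred (Edge n → ℝ>0) ℓ → Set (lsuc 0ℓ ⊔ ℓ)
Γ-Invariant D = ∀ λ′ x → x ∈ D → λ′ · x ∈ D

module _ {X : Setoid a ℓ₁} {Y : Setoid b ℓ₂} (f : Func X Y) where
  private
    module X = Setoid X
    module Y = Setoid Y
  open Func f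

  image : Pred X.Carrier ℓ → Pred Y.Carrier (a ⊔ ℓ₂ ⊔ ℓ)
  image D y = ∃ λ x → x ∈ D × to x Y.≈ y

  fiber : Y.Carrier → Pred X.Carrier ℓ₂
  fiber y x = to x Y.≈ y

  FiberInvariant : Pred X.Carrier ℓ → Set (a ⊔ b ⊔ ℓ₂ ⊔ ℓ)
  FiberInvariant D = ∀ y → y ∈ image D → fiber y ⊆ D

{-# OPTIONS --safe #-}

-- Two points of one fiber differ by a family z of edge weights all of whose matching
-- products are 1.  Two matchings that differ only by trading {p₀,p₁}, {p₂,p₃} for
-- {p₀,p₂}, {p₁,p₃} give z₀₁ z₂₃ = z₀₂ z₁₃, so z₀ᵢ z₀ⱼ / zᵢⱼ does not depend on i, j.
-- With λ₀ the square root of this constant and λᵢ = z₀ᵢ / λ₀ we get zᵢⱼ = λᵢ λⱼ, hence the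
-- two points lie in one Γ-orbit.  The matchings come from fixed-point-free involutions of
-- the vertices, conjugated by transpositions to contain prescribed pairs.

module Submission where

open import Defs
open import Algebra.Bundles using (AbelianGroup)
import Algebra.Properties.AbelianGroup as AbelianGroupProperties
import Algebra.Properties.CommutativeSemigroup as CommutativeSemigroupProperties
open import Data.Bool.Properties using (T?)
open import Data.Fin.Base as Fin using (Fin; zero; suc)
open import Data.Fin.Permutation.Components using (transpose)
import Data.Fin.Properties as Fin
open import Data.List.Base using (List; []; _∷_; filter; filterᵇ; foldr; map; mapMaybe)
open import Data.List.Membership.Propositional using () renaming (_∈_ to _∈ˡ_)
open import Data.List.Membership.Propositional.Properties using (∈-allFin; ∈-cartesianProduct⁺)
open import Data.List.Properties using (filter-accept; filter-reject; filter-≐)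
open import Data.List.Relation.Unary.All as All using (All; []; _∷_)
import Data.List.Relation.Unary.All.Properties as All
open import Data.List.Relation.Unary.AllPairs using ([]; _∷_)
open import Data.List.Relation.Unary.Any as Any using (here; there)
import Data.List.Relation.Unary.Any.Properties as Any
open import Data.List.Relation.Unary.Unique.Propositional using (Unique)
open import Data.List.Relation.Unary.Unique.Propositional.Properties using (allFin⁺; cartesianProduct⁺)
open import Data.Maybe.Base using (Maybe; just; nothing)
import Data.Maybe.Relation.Unary.All as Maybe
import Data.Maybe.Relation.Unary.Any as MaybeAny
open import Data.Nat.Base as ℕ using (zero; suc; s≤s; z<s; s<s; s<s⁻¹)
open import Data.Nat.Base using (ℕ; _≤_)
open import Data.Nat.Divisibility using (_∣_; divides)
open import Data.Product.Base using (∃; _×_; _,_; proj₁; proj₂; uncurry)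
open import Data.Rational.Base using (ℚ; 0ℚ; 1ℚ; ½; _+_; _*_; 1/_; positive; Positive; NonZero) renaming (_<_ to _<ℚ_; _≤_ to _≤ℚ_)
import Data.Rational.Properties as ℚ
open import Data.Sum.Base using (_⊎_; inj₁; inj₂)
open import Function.Base using (_∘_)
open import Level using (0ℓ) renaming (suc to lsuc)
open import Relation.Binary.Bundles using (Setoid)
open import Relation.Binary.Definitions using (_Respects_; DecidableEquality; tri<; tri≈; tri>)
open import Relation.Binary.PropositionalEquality using (_≡_; _≢_; refl; sym; trans; cong; subst; ≢-sym)
open import Relation.Nullary.Decidable using (Dec; yes; no; ⌊_⌋; toWitness; fromWitness; from-yes; map′; _×-dec_; ¬?; recompute)
open import Relation.Nullary.Negation using (¬_; contradiction)
open import Relation.Unary using (Pred; Decidable; _∈_; _⊆_)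

private variable
  n : ℕ

-- The multiplicative group of positive reals

0<1 : 0ℚ <ℚ 1ℚ
0<1 = from-yes (0ℚ ℚ.<? 1ℚ)

p<p+1 : ∀ p → p <ℚ p + 1ℚ
p<p+1 p = subst (_<ℚ p + 1ℚ) (ℚ.+-identityʳ p) (ℚ.+-monoʳ-< p 0<1)

*-monoˡ-< : ∀ {p q r} → 0ℚ <ℚ r → p <ℚ q → p * r <ℚ q * r
*-monoˡ-< {r = r} 0<r = ℚ.*-monoˡ-<-pos r {{positive 0<r}}

*-monoʳ-< : ∀ {p q r} → 0ℚ <ℚ r → p <ℚ q → r * p <ℚ r * q
*-monoʳ-< {r = r} 0<r = ℚ.*-monoʳ-<-pos r {{positive 0<r}}

*-monoʳ-≤ : ∀ {p q r} → 0ℚ <ℚ r → p ≤ℚ q → r * p ≤ℚ r * q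
*-monoʳ-≤ {r = r} 0<r = ℚ.*-monoˡ-≤-nonNeg r {{ℚ.pos⇒nonNeg r {{positive 0<r}}}}

*-mono-<-≤ : ∀ {p q r s} → 0ℚ <ℚ p → p <ℚ q → 0ℚ <ℚ r → r ≤ℚ s → p * r <ℚ q * s
*-mono-<-≤ 0<p p<q 0<r r≤s =
  ℚ.<-≤-trans (*-monoˡ-< 0<r p<q) (*-monoʳ-≤ (ℚ.<-trans 0<p p<q) r≤s)

square-cancel-< : ∀ {p q} → 0ℚ <ℚ q → p * p <ℚ q * q → p <ℚ q
square-cancel-< {p} {q} 0<q p²<q² with ℚ.<-cmp p q
... | tri< p<q _ _ = p<q
... | tri≈ _ refl _ = contradiction p²<q² (ℚ.<-irrefl refl)
... | tri> _ _ q<p = contradiction p²<q² (ℚ.<-asym (*-mono-<-≤ 0<q q<p 0<q (ℚ.<⇒≤ q<p)))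

reciprocal : ∀ {p} → 0ℚ <ℚ p → ∃ λ w → 0ℚ <ℚ w × p * w ≡ 1ℚ
reciprocal {p} 0<p = 1/ p , ℚ.positive⁻¹ (1/ p) {{ℚ.1/pos⇒pos p}} , ℚ.*-inverseʳ p
  where instance
    p-pos : Positive p
    p-pos = positive 0<p
    p-nonZero : NonZero p
    p-nonZero = ℚ.pos⇒nonZero p

reciprocal-anti-< : ∀ {p q v w} → 0ℚ <ℚ p → 0ℚ <ℚ v → p * v ≡ 1ℚ → q * w ≡ 1ℚ →
                    p <ℚ q → w <ℚ v
reciprocal-anti-< {v = v} {w} 0<p 0<v pv≡1 qw≡1 p<q with w ℚ.<? v
... | yes w<v = w<v
... | no  w≮v = contradiction (*-mono-<-≤ 0<p p<q 0<v (ℚ.≮⇒≥ w≮v))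
                  (ℚ.<-irrefl (trans pv≡1 (sym qw≡1)))

upper-positive : ∀ ((x , _) : ℝ>0) {u} → u ∈ upper x → 0ℚ <ℚ u
upper-positive (x , 0<x) = lower<upper x 0<x

-- Locatedness supplies the converse inclusions.
⊆⇒≃ : ∀ x y → lower x ⊆ lower y → upper x ⊆ upper y → x ≃ y
⊆⇒≃ x y L⊆ U⊆ = (L⊆ , L⊇) , (U⊆ , U⊇)
  where
  L⊇ : lower y ⊆ lower x
  L⊇ q∈ with lower-open y q∈
  ... | r , q<r , r∈ with located x q<r
  ... | inj₁ q∈x = q∈x
  ... | inj₂ r∈x = contradiction (U⊆ r∈x) (disjoint y r∈)

  U⊇ : upper y ⊆ upper x
  U⊇ r∈ with upper-open y r∈
  ... | q , q<r , q∈ with located x q<r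
  ... | inj₁ q∈x = contradiction q∈ (disjoint y (L⊆ q∈x))
  ... | inj₂ r∈x = r∈x

-- A and B need only generate the cut: they are closed up and made open here.
module PositiveCut (A B : Pred ℚ 0ℓ)
  (A-inhabited : ∃ λ p → 0ℚ <ℚ p × p ∈ A)
  (B-inhabited : ∃ λ p → 0ℚ <ℚ p × p ∈ B)
  (A<B : ∀ {p q} → 0ℚ <ℚ p → 0ℚ <ℚ q → p ∈ A → q ∈ B → p <ℚ q)
  (AB-located : ∀ {q r} → 0ℚ <ℚ q → q <ℚ r → q ∈ A ⊎ r ∈ B) where

  L U : Pred ℚ 0ℓ
  L q = ∃ λ p → 0ℚ <ℚ p × p ∈ A × q <ℚ p
  U q = ∃ λ p → 0ℚ <ℚ p × p ∈ B × p <ℚ q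

  L-located : ∀ {q r} → q <ℚ r → L q ⊎ U r
  L-located {q} {r} q<r with q ℚ.<? 0ℚ
  ... | yes q<0 = let p , 0<p , p∈ = A-inhabited in inj₁ (p , 0<p , p∈ , ℚ.<-trans q<0 0<p)
  -- Two intermediate points `m < m′` are needed: `AB-located` asks for a positive left argument
  -- although q may be 0, and membership in `L` and `U` asks for strict inequalities.
  ... | no  q≮0 with ℚ.<-dense q<r
  ... | m , q<m , m<r with ℚ.<-dense m<r
  ... | m′ , m<m′ , m′<r with ℚ.≤-<-trans (ℚ.≮⇒≥ q≮0) q<m
  ... | 0<m with AB-located 0<m m<m′
  ... | inj₁ m∈  = inj₁ (m , 0<m , m∈ , q<m)
  ... | inj₂ m′∈ = inj₂ (m′ , ℚ.<-trans 0<m m<m′ , m′∈ , m′<r)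

  real : ℝ>0
  real = record
    { lower = L
    ; upper = U
    ; lower-inhabited = let p , 0<p , p∈ = A-inhabited in 0ℚ , p , 0<p , p∈ , 0<p
    ; upper-inhabited = let p , 0<p , p∈ = B-inhabited in p + 1ℚ , p , 0<p , p∈ , p<p+1 p
    ; lower-closed = λ q<r (p , 0<p , p∈ , r<p) → p , 0<p , p∈ , ℚ.<-trans q<r r<p
    ; upper-closed = λ q<r (p , 0<p , p∈ , p<q) → p , 0<p , p∈ , ℚ.<-trans p<q q<r
    ; lower-open = λ (p , 0<p , p∈ , q<p) →
        let r , q<r , r<p = ℚ.<-dense q<p in r , q<r , p , 0<p , p∈ , r<p
    ; upper-open = λ (p , 0<p , p∈ , p<r) →
        let q , p<q , q<r = ℚ.<-dense p<r in q , q<r , p , 0<p , p∈ , p<q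
    ; disjoint = λ (p , 0<p , p∈ , q<p) (p′ , 0<p′ , p′∈ , p′<q) →
        ℚ.<-asym (ℚ.<-trans p′<q q<p) (A<B 0<p 0<p′ p∈ p′∈)
    ; located = L-located
    } , (let p , 0<p , p∈ = A-inhabited in p , 0<p , p∈ , 0<p)

-- Square roots and inverses of positive reals

module Sqrt (x⁺ : ℝ>0) where
  private
    x = proj₁ x⁺

  A B : Pred ℚ 0ℓ
  A p = p * p ∈ lower x
  B p = p * p ∈ upper x

  -- A positive lower bound l below 1 satisfies l² < l. If l ≥ 1, then ½ serves, its square being
  -- less than 1.
  A-inhabited : ∃ λ p → 0ℚ <ℚ p × p ∈ A
  A-inhabited with lower-open x (proj₂ x⁺)
  ... | l , 0<l , l∈ with l ℚ.<? 1ℚ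
  ... | yes l<1 = l , 0<l ,
    lower-closed x (subst (l * l <ℚ_) (ℚ.*-identityʳ l) (*-monoʳ-< 0<l l<1)) l∈
  ... | no  l≮1 = ½ , from-yes (0ℚ ℚ.<? ½) ,
    lower-closed x (ℚ.<-≤-trans (from-yes (½ * ½ ℚ.<? 1ℚ)) (ℚ.≮⇒≥ l≮1)) l∈

  -- An upper bound u may be less than 1, and then u² < u. Adding 1 repairs this: (u + 1)² > u + 1 >
  -- u.
  B-inhabited : ∃ λ p → 0ℚ <ℚ p × p ∈ B
  B-inhabited with upper-inhabited x
  ... | u , u∈ = u + 1ℚ , 0<u+1 , upper-closed x (ℚ.<-trans (p<p+1 u)
    (subst (_<ℚ (u + 1ℚ) * (u + 1ℚ)) (ℚ.*-identityʳ (u + 1ℚ)) (*-monoʳ-< 0<u+1 1<u+1))) u∈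
    where
    0<u = upper-positive x⁺ u∈
    0<u+1 = ℚ.<-trans 0<u (p<p+1 u)
    1<u+1 = subst (_<ℚ u + 1ℚ) (ℚ.+-identityˡ 1ℚ) (ℚ.+-monoˡ-< 1ℚ 0<u)

  open PositiveCut A B A-inhabited B-inhabited
    (λ _ 0<q p∈ q∈ → square-cancel-< 0<q (lower<upper x p∈ q∈))
    (λ 0<q q<r → located x (*-mono-<-≤ 0<q q<r 0<q (ℚ.<⇒≤ q<r)))
    public using (real)

  real*real≃x : proj₁ (real *⁺ real) ≃ x
  real*real≃x = ⊆⇒≃ (proj₁ (real *⁺ real)) x
    (λ (p , s , 0<p , 0<s , (p′ , 0<p′ , p′∈ , p<p′) , (s′ , 0<s′ , s′∈ , s<s′) , q<ps) →
      lower-closed x (ℚ.<-trans q<ps (*-mono-<-≤ 0<p p<p′ 0<s (ℚ.<⇒≤ s<s′)))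
        (L-product 0<p′ 0<s′ p′∈ s′∈))
    (λ (p , s , (p′ , 0<p′ , p′∈ , p′<p) , (s′ , 0<s′ , s′∈ , s′<s) , ps<q) →
      upper-closed x (ℚ.<-trans (*-mono-<-≤ 0<p′ p′<p 0<s′ (ℚ.<⇒≤ s′<s)) ps<q)
        (U-product 0<p′ 0<s′ p′∈ s′∈))
    where
    -- The product is at most the square of the larger factor, and that square lies in the lower
    -- cut. For `U-product` the smaller factor plays this part.
    L-product : ∀ {p s} → 0ℚ <ℚ p → 0ℚ <ℚ s → p ∈ A → s ∈ A → p * s ∈ lower x
    L-product {p} {s} 0<p 0<s p∈ s∈ with ℚ.<-cmp p s
    ... | tri< p<s _ _ = lower-closed x (*-monoˡ-< 0<s p<s) s∈
    ... | tri≈ _ refl _ = p∈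
    ... | tri> _ _ s<p = lower-closed x (*-monoʳ-< 0<p s<p) p∈

    U-product : ∀ {p s} → 0ℚ <ℚ p → 0ℚ <ℚ s → p ∈ B → s ∈ B → p * s ∈ upper x
    U-product {p} {s} 0<p 0<s p∈ s∈ with ℚ.<-cmp p s
    ... | tri< p<s _ _ = upper-closed x (*-monoʳ-< 0<p p<s) p∈
    ... | tri≈ _ refl _ = p∈
    ... | tri> _ _ s<p = upper-closed x (*-monoˡ-< 0<s s<p) s∈

module Inverse (x⁺ : ℝ>0) where
  private
    x = proj₁ x⁺

  -- Reciprocals are expressed by an equation instead of `1/_`, which keeps `NonZero` instances out
  -- of the cuts.
  A B : Pred ℚ 0ℓ
  A p = ∃ λ u → u ∈ upper x × u * p ≡ 1ℚ
  B p = ∃ λ l → 0ℚ <ℚ l × l ∈ lower x × l * p ≡ 1ℚ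

  A-inhabited : ∃ λ p → 0ℚ <ℚ p × p ∈ A
  A-inhabited =
    let u , u∈ = upper-inhabited x
        w , 0<w , uw≡1 = reciprocal (upper-positive x⁺ u∈)
    in w , 0<w , u , u∈ , uw≡1

  B-inhabited : ∃ λ p → 0ℚ <ℚ p × p ∈ B
  B-inhabited =
    let l , 0<l , l∈ = lower-open x (proj₂ x⁺)
        w , 0<w , lw≡1 = reciprocal 0<l
    in w , 0<w , l , 0<l , l∈ , lw≡1

  -- Inversion reverses the order, so x is located between the reciprocals w of r and v of q, where
  -- w < v.
  AB-located : ∀ {q r} → 0ℚ <ℚ q → q <ℚ r → q ∈ A ⊎ r ∈ B
  AB-located {q} {r} 0<q q<r with reciprocal 0<q | reciprocal (ℚ.<-trans 0<q q<r)
  ... | v , 0<v , qv≡1 | w , 0<w , rw≡1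
    with located x (reciprocal-anti-< 0<q 0<v qv≡1 rw≡1 q<r)
  ... | inj₁ w∈ = inj₂ (w , 0<w , w∈ , trans (ℚ.*-comm w r) rw≡1)
  ... | inj₂ v∈ = inj₁ (v , v∈ , trans (ℚ.*-comm v q) qv≡1)

  open PositiveCut A B A-inhabited B-inhabited
    (λ _ 0<q (u , u∈ , up≡1) (l , 0<l , l∈ , lq≡1) →
      reciprocal-anti-< 0<l 0<q lq≡1 up≡1 (lower<upper x l∈ u∈))
    AB-located
    public using (real)

  -- A lower bound p of x is below any upper bound u, so p times a number below 1/u stays below u ·
  -- 1/u = 1; dually for upper bounds.
  x*real≃1 : proj₁ (x⁺ *⁺ real) ≃ proj₁ 1ℝ>0
  x*real≃1 = ⊆⇒≃ (proj₁ (x⁺ *⁺ real)) (proj₁ 1ℝ>0)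
    (λ {q} (p , s , 0<p , 0<s , p∈ , (w , 0<w , (u , u∈ , uw≡1) , s<w) , q<ps) →
      subst (q <ℚ_) uw≡1 (ℚ.<-trans q<ps (*-mono-<-≤ 0<p (lower<upper x p∈ u∈) 0<s (ℚ.<⇒≤ s<w))))
    (λ {q} (u , v , u∈ , (w , 0<w , (l , 0<l , l∈ , lw≡1) , w<v) , uv<q) →
      subst (_<ℚ q) lw≡1 (ℚ.<-trans (*-mono-<-≤ 0<l (lower<upper x l∈ u∈) 0<w (ℚ.<⇒≤ w<v)) uv<q))

infix 8 _⁻¹⁺

_⁻¹⁺ : ℝ>0 → ℝ>0
x ⁻¹⁺ = Inverse.real x

-- Laws of the multiplicative group

*⁺-comm : ∀ x y → x *⁺ y ≈ y *⁺ x
*⁺-comm x y = ⊆⇒≃ (proj₁ (x *⁺ y)) (proj₁ (y *⁺ x))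
  (λ {q} (p , s , 0<p , 0<s , p∈ , s∈ , q<ps) →
    s , p , 0<s , 0<p , s∈ , p∈ , subst (q <ℚ_) (ℚ.*-comm p s) q<ps)
  (λ {q} (u , v , u∈ , v∈ , uv<q) → v , u , v∈ , u∈ , subst (_<ℚ q) (ℚ.*-comm u v) uv<q)

*⁺-assoc : ∀ x y z → (x *⁺ y) *⁺ z ≈ x *⁺ (y *⁺ z)
*⁺-assoc x y z = ⊆⇒≃ (proj₁ ((x *⁺ y) *⁺ z)) (proj₁ (x *⁺ (y *⁺ z)))
  (λ {q} (p , s , 0<p , 0<s , (a , b , 0<a , 0<b , a∈ , b∈ , p<ab) , s∈ , q<ps) →
    -- The lower cut of `y *⁺ z` demands a product strictly above `b * s`, so s is first enlarged to
    -- s′ within the lower cut of z.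
    let s′ , s<s′ , s′∈ = lower-open (proj₁ z) s∈
        0<bs = subst (_<ℚ b * s) (ℚ.*-zeroʳ b) (*-monoʳ-< 0<b 0<s)
    in a , b * s , 0<a , 0<bs , a∈ ,
       (b , s′ , 0<b , ℚ.<-trans 0<s s<s′ , b∈ , s′∈ , *-monoʳ-< 0<b s<s′) ,
       ℚ.<-trans q<ps (subst (p * s <ℚ_) (ℚ.*-assoc a b s) (*-monoˡ-< 0<s p<ab)))
  (λ {q} (u , v , (a , b , a∈ , b∈ , ab<u) , v∈ , uv<q) →
    let v′ , v′<v , v′∈ = upper-open (proj₁ z) v∈
    in a , b * v , a∈ ,
       (b , v′ , b∈ , v′∈ , *-monoʳ-< (upper-positive y b∈) v′<v) ,
       ℚ.<-trans (subst (_<ℚ u * v) (ℚ.*-assoc a b v) (*-monoˡ-< (upper-positive z v∈) ab<u)) uv<q)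

*⁺-identityˡ : ∀ x → 1ℝ>0 *⁺ x ≈ x
*⁺-identityˡ x⁺@(x , _) = ⊆⇒≃ (proj₁ (1ℝ>0 *⁺ x⁺)) x
  (λ (p , s , 0<p , 0<s , p<1 , s∈ , q<ps) →
    lower-closed x (ℚ.<-trans q<ps (subst (p * s <ℚ_) (ℚ.*-identityˡ s) (*-monoˡ-< 0<s p<1))) s∈)
  (λ (u , v , 1<u , v∈ , uv<q) → upper-closed x (ℚ.<-trans
    (subst (_<ℚ u * v) (ℚ.*-identityˡ v) (*-monoˡ-< (upper-positive x⁺ v∈) 1<u)) uv<q) v∈)

*⁺-inverseʳ : ∀ x → x *⁺ x ⁻¹⁺ ≈ 1ℝ>0
*⁺-inverseʳ = Inverse.x*real≃1

⁻¹⁺-cong : ∀ {x y} → x ≈ y → x ⁻¹⁺ ≈ y ⁻¹⁺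
⁻¹⁺-cong {x} {y} ((L⊆ , _) , (U⊆ , _)) = ⊆⇒≃ (proj₁ (x ⁻¹⁺)) (proj₁ (y ⁻¹⁺))
  (λ (w , 0<w , (u , u∈ , uw≡1) , q<w) → w , 0<w , (u , U⊆ u∈ , uw≡1) , q<w)
  (λ (w , 0<w , (l , 0<l , l∈ , lw≡1) , w<q) → w , 0<w , (l , 0<l , L⊆ l∈ , lw≡1) , w<q)

ℝ>0-abelianGroup : AbelianGroup (lsuc 0ℓ) 0ℓ
ℝ>0-abelianGroup = record
  { Carrier = ℝ>0
  ; _≈_ = _≈_
  ; _∙_ = _*⁺_
  ; ε = 1ℝ>0
  ; _⁻¹ = _⁻¹⁺
  ; isAbelianGroup = record
    { isGroup = record
      { isMonoid = record
        { isSemigroup = record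
          { isMagma = record
            { isEquivalence = Setoid.isEquivalence ℝ>0-setoid
            ; ∙-cong = λ {x} {y} {u} {v} → *⁺-cong {x} {y} {u} {v}
            }
          ; assoc = *⁺-assoc
          }
        ; identity = *⁺-identityˡ , λ x →
            ≈-trans {x *⁺ 1ℝ>0} {1ℝ>0 *⁺ x} {x} (*⁺-comm x 1ℝ>0) (*⁺-identityˡ x)
        }
      ; inverse = (λ x → ≈-trans {x ⁻¹⁺ *⁺ x} {x *⁺ x ⁻¹⁺} {1ℝ>0} (*⁺-comm (x ⁻¹⁺) x) (*⁺-inverseʳ x)) ,
          *⁺-inverseʳ
      ; ⁻¹-cong = λ {x} {y} → ⁻¹⁺-cong {x} {y}
      }
    ; comm = *⁺-comm
    }
  }

sqrt : ∀ x → ∃ λ r → r *⁺ r ≈ x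
sqrt x = Sqrt.real x , Sqrt.real*real≃x x

-- Edges of the complete graph

-- Injectivity is demanded only where f is defined, since `edge?` sends all pairs that are not
-- increasing to `nothing`.
mapMaybe-unique : ∀ {A B : Set} (f : A → Maybe B) →
  (∀ {x y b} → f x ≡ just b → f y ≡ just b → x ≡ y) →
  ∀ {xs} → Unique xs → Unique (mapMaybe f xs)
mapMaybe-unique f f-inj [] = []
mapMaybe-unique f f-inj {x ∷ xs} (x∉xs ∷ xs!) with f x in fx≡
... | nothing = mapMaybe-unique f f-inj xs!
... | just b  = All.mapMaybe⁺ (All.map⁺ (All.map b≢ x∉xs)) ∷ mapMaybe-unique f f-inj xs!
  where
  b≢ : ∀ {y} → x ≢ y → Maybe.All (b ≢_) (f y)
  b≢ {y} x≢y with f y in fy≡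
  ... | nothing = Maybe.nothing
  ... | just c  = Maybe.just λ { refl → x≢y (f-inj fx≡ fy≡) }

edge?-just : ∀ {i j : Fin n} {e} → edge? i j ≡ just e → (i , j) ≡ (lo e , hi e)
edge?-just {i = i} {j} _ with i Fin.<? j
edge?-just refl | yes _ = refl

edges-unique : ∀ n → Unique (edges n)
edges-unique n = mapMaybe-unique (uncurry edge?)
  (λ p q → trans (edge?-just p) (sym (edge?-just q)))
  (cartesianProduct⁺ (allFin⁺ n) (allFin⁺ n))

edges-complete : ∀ (e : Edge n) → e ∈ˡ edges n
edges-complete e@(edge i j i<j) = Any.mapMaybe⁺ (uncurry edge?) _
  (Any.map⁺ (Any.map (λ { refl → found }) (∈-cartesianProduct⁺ (∈-allFin i) (∈-allFin j))))
  where
  found : MaybeAny.Any (e ≡_) (edge? i j)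
  found with i Fin.<? j
  ... | yes _   = MaybeAny.just refl
  ... | no  i≮j = contradiction (recompute (i Fin.<? j) i<j) i≮j

-- The inequality stored in an edge is irrelevant, so matching on the endpoints suffices.
edge-≡ : ∀ {e f : Edge n} → lo e ≡ lo f → hi e ≡ hi f → e ≡ f
edge-≡ refl refl = refl

lo-below-hi : ∀ (e : Edge n) → lo e Fin.< hi e
lo-below-hi (edge i j i<j) = recompute (i Fin.<? j) i<j

infix 4 _≟_

_≟_ : DecidableEquality (Edge n)
e ≟ f = map′ (uncurry edge-≡) (λ { refl → refl , refl }) (lo e Fin.≟ lo f ×-dec hi e Fin.≟ hi f)

-- Forgets the orientation, so that pairs of vertices can be prescribed without knowing which one is
-- smaller.
data Joins (e : Edge n) (u v : Fin n) : Set where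
  forward  : lo e ≡ u → hi e ≡ v → Joins e u v
  backward : lo e ≡ v → hi e ≡ u → Joins e u v

Joins-sym : ∀ {e : Edge n} {u v} → Joins e u v → Joins e v u
Joins-sym (forward p q)  = backward p q
Joins-sym (backward p q) = forward p q

Joins-unique : ∀ {e f : Edge n} {u v} → Joins e u v → Joins f u v → e ≡ f
Joins-unique (forward refl refl) (forward p q) = edge-≡ (sym p) (sym q)
Joins-unique (backward refl refl) (backward p q) = edge-≡ (sym p) (sym q)
-- Opposite orientations would give both u < v and v < u.
Joins-unique {e = e} {f} (forward refl refl) (backward refl refl) =
  contradiction (lo-below-hi f) (Fin.<-asym (lo-below-hi e))
Joins-unique {e = e} {f} (backward refl refl) (forward refl refl) =
  contradiction (lo-below-hi f) (Fin.<-asym (lo-below-hi e))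

Joins⇒Incident : ∀ {e : Edge n} {u v} → Joins e u v → Incident u e
Joins⇒Incident (forward p _) = inj₁ (sym p)
Joins⇒Incident (backward _ p) = inj₂ (sym p)

joining : ∀ {u v : Fin n} → u ≢ v → ∃ λ e → Joins e u v
joining {u = u} {v} u≢v with Fin.<-cmp u v
... | tri< u<v _ _ = edge u v u<v , forward refl refl
... | tri≈ _ u≡v _ = contradiction u≡v u≢v
... | tri> _ _ v<u = edge v u v<u , backward refl refl

-- Fixed-point-free involutions

transpose-left : ∀ (i j : Fin n) → transpose i j i ≡ j
transpose-left i j with i Fin.≟ i
... | yes _   = refl
... | no  i≢i = contradiction refl i≢i

transpose-right : ∀ (i j : Fin n) → transpose i j j ≡ i
transpose-right i j with j Fin.≟ i
... | yes j≡i = j≡i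
... | no  _ with j Fin.≟ j
...   | yes _   = refl
...   | no  j≢j = contradiction refl j≢j

transpose-fixed : ∀ {i j k : Fin n} → k ≢ i → k ≢ j → transpose i j k ≡ k
transpose-fixed {i = i} {j} {k} k≢i k≢j with k Fin.≟ i
... | yes k≡i = contradiction k≡i k≢i
... | no  _ with k Fin.≟ j
...   | yes k≡j = contradiction k≡j k≢j
...   | no  _   = refl

transpose-involutive : ∀ (i j k : Fin n) → transpose i j (transpose i j k) ≡ k
transpose-involutive i j k with k Fin.≟ i
... | yes refl = transpose-right i j
... | no  k≢i with k Fin.≟ j
...   | yes refl = transpose-left i j
...   | no  k≢j  = transpose-fixed k≢i k≢j

record Pairing (n : ℕ) : Set where
  field
    partner     : Fin n → Fin n
    involutive  : ∀ v → partner (partner v) ≡ v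
    irreflexive : ∀ v → partner v ≢ v

  partner-sym : ∀ {u v} → partner u ≡ v → partner v ≡ u
  partner-sym {u} refl = involutive u

  partner-injective : ∀ {u v} → partner u ≡ partner v → u ≡ v
  partner-injective {v = v} eq = trans (sym (partner-sym eq)) (involutive v)

  Matched : Pred (Edge n) _
  Matched e = partner (lo e) ≡ hi e

  Matched? : Decidable Matched
  Matched? e = partner (lo e) Fin.≟ hi e

  Joins⇒Matched : ∀ {e u v} → Joins e u v → partner u ≡ v → Matched e
  Joins⇒Matched (forward refl refl) pu≡v = pu≡v
  Joins⇒Matched (backward refl refl) pu≡v = partner-sym pu≡v

  Matched⇒Joins : ∀ {e v} → Matched e → Incident v e → Joins e v (partner v)
  Matched⇒Joins m (inj₁ refl) = forward refl (sym m)
  Matched⇒Joins m (inj₂ refl) = backward (sym (partner-sym m)) refl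

  matching : PerfectMatching n
  matching = record
    { member = λ e → ⌊ Matched? e ⌋
    ; covered-once = λ v →
        let e , e-joins = joining (≢-sym (irreflexive v))
        in e , (fromWitness (Joins⇒Matched e-joins refl) , Joins⇒Incident e-joins) ,
           -- Any selected edge at v joins v to its partner, and so does e.
           λ (m , inc) → Joins-unique e-joins (Matched⇒Joins (toWitness m) inc)
    }

open Pairing

flip : ∀ k → Fin (k ℕ.* 2) → Fin (k ℕ.* 2)
flip (suc k) zero          = suc zero
flip (suc k) (suc zero)    = zero
flip (suc k) (suc (suc v)) = suc (suc (flip k v))

-- Evenness of the number of vertices enters here: it provides a first pairing, from which
-- conjugation produces those with prescribed pairs.
evenPairing : ∀ k → Pairing (k ℕ.* 2)
evenPairing k = record
  { partner     = flip k
  ; involutive  = flip-involutive k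
  ; irreflexive = flip-irreflexive k
  }
  where
  flip-involutive : ∀ k v → flip k (flip k v) ≡ v
  flip-involutive (suc k) zero          = refl
  flip-involutive (suc k) (suc zero)    = refl
  flip-involutive (suc k) (suc (suc v)) = cong (λ w → suc (suc w)) (flip-involutive k v)

  flip-irreflexive : ∀ k v → flip k v ≢ v
  flip-irreflexive (suc k) (suc (suc v)) eq =
    flip-irreflexive k v (Fin.suc-injective (Fin.suc-injective eq))

conjugate : Fin n → Fin n → Pairing n → Pairing n
conjugate i j p = record
  { partner = λ v → t (partner p (t v))
  ; involutive = λ v → trans (cong (t ∘ partner p) (tt (partner p (t v))))
      (trans (cong t (involutive p (t v))) (tt v))
  ; irreflexive = λ v eq → irreflexive p (t v) (trans (sym (tt _)) (cong t eq))
  }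
  where
  t = transpose i j
  tt = transpose-involutive i j

conjugate-partner : ∀ i j (p : Pairing n) {v} → v ≢ i → v ≢ j →
                    partner (conjugate i j p) v ≡ transpose i j (partner p v)
conjugate-partner i j p v≢i v≢j = cong (transpose i j ∘ partner p) (transpose-fixed v≢i v≢j)

conjugate-partner-fixed : ∀ i j (p : Pairing n) {v} → v ≢ i → v ≢ j →
                          partner p v ≢ i → partner p v ≢ j →
                          partner (conjugate i j p) v ≡ partner p v
conjugate-partner-fixed i j p v≢i v≢j pv≢i pv≢j =
  trans (conjugate-partner i j p v≢i v≢j) (transpose-fixed pv≢i pv≢j)

-- Swapping the labels of v and of the present partner of u makes v the partner of u; if these two
-- points differ, the former partner of u inherits the partner of v.
pairUp : Fin n → Fin n → Pairing n → Pairing n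
pairUp u v p = conjugate (partner p u) v p

pairUp-partner : ∀ (p : Pairing n) {u v} → u ≢ v → partner (pairUp u v p) u ≡ v
pairUp-partner p {u} {v} u≢v =
  trans (conjugate-partner (partner p u) v p (≢-sym (irreflexive p u)) u≢v)
    (transpose-left (partner p u) v)

-- Lets `extendPairs` force a second pair without destroying the first. A pair disjoint from {u, v}
-- also avoids `partner p u`, whose partner is u.
pairUp-preserves : ∀ (p : Pairing n) {u v w} → w ≢ u → w ≢ v → partner p w ≢ u → partner p w ≢ v →
                   partner (pairUp u v p) w ≡ partner p w
pairUp-preserves p {u} {v} w≢u w≢v pw≢u pw≢v = conjugate-partner-fixed (partner p u) v p
  (λ { refl → pw≢u (involutive p u) }) w≢v (w≢u ∘ partner-injective p) pw≢v

-- Exchanging two pairs on four vertices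

record Distinct₄ (p₀ p₁ p₂ p₃ : Fin n) : Set where
  constructor distinct₄
  field
    p₀≢p₁ : p₀ ≢ p₁
    p₀≢p₂ : p₀ ≢ p₂
    p₀≢p₃ : p₀ ≢ p₃
    p₁≢p₂ : p₁ ≢ p₂
    p₁≢p₃ : p₁ ≢ p₃
    p₂≢p₃ : p₂ ≢ p₃

AgreeOff : Pairing n → Pairing n → (p₀ p₁ p₂ p₃ : Fin n) → Set
AgreeOff p q p₀ p₁ p₂ p₃ = ∀ {v} → v ≢ p₀ → v ≢ p₁ → v ≢ p₂ → v ≢ p₃ → partner p v ≡ partner q v

module _ {p₀ p₁ p₂ p₃ : Fin n} (distinct : Distinct₄ p₀ p₁ p₂ p₃) where
  open Distinct₄ distinct

  extendPairs : Pairing n → ∃ λ p → partner p p₀ ≡ p₁ × partner p p₂ ≡ p₃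
  extendPairs p = pairUp p₂ p₃ q , trans (pairUp-preserves q p₀≢p₂ p₀≢p₃
      (λ eq → p₁≢p₂ (trans (sym qp₀) eq)) (λ eq → p₁≢p₃ (trans (sym qp₀) eq))) qp₀ ,
    pairUp-partner q p₂≢p₃
    where
    q = pairUp p₀ p₁ p
    qp₀ = pairUp-partner p p₀≢p₁

  -- Conjugation by the transposition of p₁ and p₂ does it. A vertex outside the four is fixed, and
  -- so is its partner, because p₁ and p₂ have the partners p₀ and p₃.
  exchangePairs : ∀ p → partner p p₀ ≡ p₁ → partner p p₂ ≡ p₃ →
    ∃ λ q → partner q p₀ ≡ p₂ × partner q p₁ ≡ p₃ × AgreeOff p q p₀ p₁ p₂ p₃
  exchangePairs p pp₀ pp₂ = conjugate p₁ p₂ p ,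
    trans (conjugate-partner p₁ p₂ p p₀≢p₁ p₀≢p₂) (trans (cong t pp₀) (transpose-left p₁ p₂)) ,
    trans (cong (t ∘ partner p) (transpose-left p₁ p₂))
      (trans (cong t pp₂) (transpose-fixed (≢-sym p₁≢p₃) (≢-sym p₂≢p₃))) ,
    λ v≢p₀ v≢p₁ v≢p₂ v≢p₃ → sym (conjugate-partner-fixed p₁ p₂ p v≢p₁ v≢p₂
      (λ pv≡p₁ → v≢p₀ (partner-injective p (trans pv≡p₁ (sym pp₀))))
      (λ pv≡p₂ → v≢p₃ (partner-injective p (trans pv≡p₂ (sym (partner-sym p pp₂))))))
    where t = transpose p₁ p₂

-- Removing edges from a matching

Without : ∀ {ℓ} → Pred (Edge n) ℓ → Edge n → Pred (Edge n) ℓ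
Without P a e = P e × e ≢ a

without? : ∀ {ℓ} {P : Pred (Edge n) ℓ} → Decidable P → ∀ a → Decidable (Without P a)
without? P? a e = P? e ×-dec ¬? (e ≟ a)

filter-without-∉ : ∀ {ℓ} {P : Pred (Edge n) ℓ} (P? : Decidable P) {a es} →
  All (a ≢_) es → filter P? es ≡ filter (without? P? a) es
filter-without-∉ P? [] = refl
filter-without-∉ P? {a} {e ∷ es} (a≢e ∷ a∉es) = by-cases (P? e)
  where
  by-cases : Dec _ → filter P? (e ∷ es) ≡ filter (without? P? a) (e ∷ es)
  by-cases (no ¬Pe) = trans (filter-reject P? ¬Pe)
    (trans (filter-without-∉ P? a∉es) (sym (filter-reject (without? P? a) (¬Pe ∘ proj₁))))
  by-cases (yes Pe) = trans (filter-accept P? Pe)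
    (trans (cong (e ∷_) (filter-without-∉ P? a∉es))
      (sym (filter-accept (without? P? a) (Pe , ≢-sym a≢e))))

-- The only edges of p that touch the four vertices are a and b. The lower end of any other edge of
-- p therefore avoids all four, so q matches it as well, and it is neither c nor d, whose ends are
-- among the four.
remainder-⊆ : ∀ {p₀ p₁ p₂ p₃} (p q : Pairing n) →
  partner p p₀ ≡ p₁ → partner p p₂ ≡ p₃ → AgreeOff p q p₀ p₁ p₂ p₃ →
  ∀ {a b c d} → Joins a p₀ p₁ → Joins b p₂ p₃ → Joins c p₀ p₂ → Joins d p₁ p₃ →
  Without (Without (Matched p) a) b ⊆ Without (Without (Matched q) c) d
remainder-⊆ {n} {p₀} {p₁} {p₂} {p₃} p q pp₀ pp₂ agree {a} {b} ja jb jc jd {e} ((m , e≢a) , e≢b) =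
  (trans (sym (agree lo≢p₀ lo≢p₁ lo≢p₂ lo≢p₃)) m ,
   λ { refl → excluded lo≢p₀ lo≢p₂ jc }) , λ { refl → excluded lo≢p₁ lo≢p₃ jd }
  where
  lo≢ : ∀ {f u v} → Joins f u v → partner p u ≡ v → e ≢ f → lo e ≢ u
  lo≢ jf pu≡v e≢f refl = e≢f (Joins-unique (forward refl (trans (sym m) pu≡v)) jf)
  lo≢p₀ = lo≢ ja pp₀ e≢a
  lo≢p₁ = lo≢ (Joins-sym ja) (partner-sym p pp₀) e≢a
  lo≢p₂ = lo≢ jb pp₂ e≢b
  lo≢p₃ = lo≢ (Joins-sym jb) (partner-sym p pp₂) e≢b
  excluded : ∀ {u v} → lo e ≢ u → lo e ≢ v → ¬ Joins e u v
  excluded lo≢u lo≢v (forward lo≡u _) = lo≢u lo≡u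
  excluded lo≢u lo≢v (backward lo≡v _) = lo≢v lo≡v

-- Weights with trivial matching products

module _ {c ℓ} (G : AbelianGroup c ℓ) where
  open AbelianGroup G
    renaming (refl to ≈ᴳ-refl; sym to ≈ᴳ-sym; trans to ≈ᴳ-trans; _≈_ to _≈ᴳ_; _-_ to _//_)
  open AbelianGroupProperties G
  open CommutativeSemigroupProperties commutativeSemigroup
  open import Relation.Binary.Reasoning.Setoid setoid

  -- For the group of positive reals this is `∏` by definition, so the products below specialise to
  -- `matchingProduct`.
  product : List Carrier → Carrier
  product = foldr _∙_ ε

  product-map-// : ∀ {A : Set} (x y : A → Carrier) es →
    product (map (λ e → x e // y e) es) ≈ᴳ product (map x es) // product (map y es)
  product-map-// x y [] = ≈ᴳ-sym (inverseʳ ε)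
  product-map-// x y (e ∷ es) = begin
    (x e // y e) ∙ product (map (λ e → x e // y e) es) ≈⟨ ∙-congˡ (product-map-// x y es) ⟩
    (x e // y e) ∙ (X // Y)          ≈⟨ interchange (x e) (y e ⁻¹) X (Y ⁻¹) ⟩
    (x e ∙ X) ∙ (y e ⁻¹ ∙ Y ⁻¹)      ≈⟨ ∙-congˡ (⁻¹-∙-comm (y e) Y) ⟩
    (x e ∙ X) // (y e ∙ Y)           ∎
    where
    X = product (map x es)
    Y = product (map y es)

  module _ (z : Edge n → Carrier) where
    ∏ᶻ : List (Edge n) → Carrier
    ∏ᶻ es = product (map z es)

    ∏[_] : ∀ {ℓ} {P : Pred (Edge n) ℓ} → Decidable P → List (Edge n) → Carrier
    ∏[ P? ] es = ∏ᶻ (filter P? es)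

    -- `Unique` guarantees that filtering out a drops exactly one factor.
    ∏-remove : ∀ {ℓ} {P : Pred (Edge n) ℓ} (P? : Decidable P) {a es} → Unique es → a ∈ˡ es → P a →
               ∏[ P? ] es ≈ᴳ z a ∙ ∏[ without? P? a ] es
    ∏-remove P? {a} {_ ∷ es} (a∉es ∷ _) (here refl) Pa = reflexive (trans
      (cong ∏ᶻ (filter-accept P? Pa))
      (cong (λ fs → z a ∙ ∏ᶻ fs) (trans (filter-without-∉ P? a∉es)
        (sym (filter-reject (without? P? a) (λ (_ , a≢a) → a≢a refl))))))
    ∏-remove P? {a} {e ∷ es} (e∉es ∷ es!) (there a∈es) Pa = by-cases (P? e)
      where
      by-cases : Dec _ → ∏[ P? ] (e ∷ es) ≈ᴳ z a ∙ ∏[ without? P? a ] (e ∷ es)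
      by-cases (no ¬Pe) = begin
        ∏[ P? ] (e ∷ es)                     ≡⟨ cong ∏ᶻ (filter-reject P? ¬Pe) ⟩
        ∏[ P? ] es                           ≈⟨ ∏-remove P? es! a∈es Pa ⟩
        z a ∙ ∏[ without? P? a ] es          ≡⟨ cong (λ fs → z a ∙ ∏ᶻ fs)
                                                  (filter-reject (without? P? a) (¬Pe ∘ proj₁)) ⟨
        z a ∙ ∏[ without? P? a ] (e ∷ es)    ∎
      by-cases (yes Pe) = begin
        ∏[ P? ] (e ∷ es)                     ≡⟨ cong ∏ᶻ (filter-accept P? Pe) ⟩
        z e ∙ ∏[ P? ] es                     ≈⟨ ∙-congˡ (∏-remove P? es! a∈es Pa) ⟩
        z e ∙ (z a ∙ ∏[ without? P? a ] es)  ≈⟨ x∙yz≈y∙xz (z e) (z a) _ ⟩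
        z a ∙ (z e ∙ ∏[ without? P? a ] es)  ≡⟨ cong (λ fs → z a ∙ ∏ᶻ fs)
                                                  (filter-accept (without? P? a) (Pe , All.lookup e∉es a∈es)) ⟨
        z a ∙ ∏[ without? P? a ] (e ∷ es)    ∎

    module _ (trivial : ∀ M → product (map z (filterᵇ (member M) (edges n))) ≈ᴳ ε) where

      ∏-matched : ∀ (p : Pairing n) {a b} → a ≢ b → Matched p a → Matched p b →
        (z a ∙ z b) ∙ ∏[ without? (without? (Matched? p) a) b ] (edges n) ≈ᴳ ε
      ∏-matched p {a} {b} a≢b ma mb = begin
        (z a ∙ z b) ∙ ∏[ without? (without? (Matched? p) a) b ] (edges n) ≈⟨ assoc (z a) (z b) _ ⟩
        z a ∙ (z b ∙ ∏[ without? (without? (Matched? p) a) b ] (edges n))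
          ≈⟨ ∙-congˡ (∏-remove (without? (Matched? p) a) (edges-unique n) (edges-complete b)
               (mb , ≢-sym a≢b)) ⟨
        z a ∙ ∏[ without? (Matched? p) a ] (edges n)
          ≈⟨ ∏-remove (Matched? p) (edges-unique n) (edges-complete a) ma ⟨
        -- The Boolean `member` of the matching and the decision `Matched?` select the same edges.
        ∏[ Matched? p ] (edges n) ≡⟨ cong ∏ᶻ
          (filter-≐ (Matched? p) (T? ∘ member (matching p)) (fromWitness , toWitness) (edges n)) ⟩
        product (map z (filterᵇ (member (matching p)) (edges n))) ≈⟨ trivial (matching p) ⟩
        ε ∎

      -- A matching containing a and b and its exchanged version containing c and d share the
      -- remaining product R. Both full products are trivial, so R cancels.
      exchange : Pairing n → ∀ {p₀ p₁ p₂ p₃} → Distinct₄ p₀ p₁ p₂ p₃ →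
        ∀ {a b c d} → Joins a p₀ p₁ → Joins b p₂ p₃ → Joins c p₀ p₂ → Joins d p₁ p₃ →
        z a ∙ z b ≈ᴳ z c ∙ z d
      exchange base {p₀} {p₁} {p₂} {p₃} distinct {a} {b} {c} {d} ja jb jc jd
        with extendPairs distinct base
      ... | p , pp₀ , pp₂ with exchangePairs distinct p pp₀ pp₂
      ... | q , qp₀ , qp₁ , agree = ∙-cancelʳ R (z a ∙ z b) (z c ∙ z d) (begin
        (z a ∙ z b) ∙ R
          ≈⟨ ∏-matched p (separated ja jb p₀≢p₂ p₀≢p₃)
               (Joins⇒Matched p ja pp₀) (Joins⇒Matched p jb pp₂) ⟩
        ε
          ≈⟨ ∏-matched q (separated jc jd p₀≢p₁ p₀≢p₃)
               (Joins⇒Matched q jc qp₀) (Joins⇒Matched q jd qp₁) ⟨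
        (z c ∙ z d) ∙ ∏[ without? (without? (Matched? q) c) d ] (edges n)
          ≡⟨ cong (λ fs → (z c ∙ z d) ∙ ∏ᶻ fs) (filter-≐
               (without? (without? (Matched? q) c) d) (without? (without? (Matched? p) a) b)
               -- The situation is symmetric under swapping p with q and p₁ with p₂, so one lemma
               -- gives both inclusions.
               (remainder-⊆ q p qp₀ qp₁ (λ v₀ v₂ v₁ v₃ → sym (agree v₀ v₁ v₂ v₃)) jc jd ja jb ,
                remainder-⊆ p q pp₀ pp₂ agree ja jb jc jd) (edges n)) ⟩
        (z c ∙ z d) ∙ R ∎)
        where
        open Distinct₄ distinct
        R = ∏[ without? (without? (Matched? p) a) b ] (edges n)
        -- The two edges differ because p₀ is an end of the first but not of the second.
        separated : ∀ {e f : Edge n} {u v w} → Joins e p₀ u → Joins f v w → p₀ ≢ v → p₀ ≢ w → e ≢ f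
        separated (forward refl _) (forward eq _) p₀≢v p₀≢w refl = p₀≢v eq
        separated (forward refl _) (backward eq _) p₀≢v p₀≢w refl = p₀≢w eq
        separated (backward _ refl) (forward _ eq) p₀≢v p₀≢w refl = p₀≢w eq
        separated (backward _ refl) (backward _ eq) p₀≢v p₀≢w refl = p₀≢v eq

  -- When the equations are multiplied, d and q drop out. In the uses below the first equation is an
  -- instance of `exchange`, the second is a known triangle identity, and s is `r ∙ r`.
  transfer : ∀ {d p e q s f} → d ∙ p ≈ᴳ e ∙ q → q ∙ s ≈ᴳ d ∙ f → p ∙ s ≈ᴳ e ∙ f
  transfer {d} {p} {e} {q} {s} {f} dp≈eq qs≈df = ∙-cancelˡ d (p ∙ s) (e ∙ f) (begin
    d ∙ (p ∙ s)  ≈⟨ assoc d p s ⟨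
    (d ∙ p) ∙ s  ≈⟨ ∙-congʳ dp≈eq ⟩
    (e ∙ q) ∙ s  ≈⟨ assoc e q s ⟩
    e ∙ (q ∙ s)  ≈⟨ ∙-congˡ qs≈df ⟩
    e ∙ (d ∙ f)  ≈⟨ x∙yz≈y∙xz e d f ⟩
    d ∙ (e ∙ f)  ∎)

  -- Vertex potentials from the star at vertex 0

  module _ {m} (base : Pairing (3 ℕ.+ m)) (z : Edge (3 ℕ.+ m) → Carrier)
    (trivial : ∀ M → product (map z (filterᵇ (member M) (edges (3 ℕ.+ m)))) ≈ᴳ ε)
    where

    -- star j is the weight of {0, j + 1}.
    star : Fin (2 ℕ.+ m) → Carrier
    star j = z (edge zero (suc j) z<s)

    z₁₂ : Carrier
    z₁₂ = z (edge (suc zero) (suc (suc zero)) (s<s z<s))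

    -- The common ratio z₀ᵢ z₀ⱼ / zᵢⱼ, read off at i = 1 and j = 2.
    λ₀² : Carrier
    λ₀² = (star zero ∙ star (suc zero)) // z₁₂

    -- A general abelian group need not have square roots, so one is assumed here; for positive
    -- reals `sqrt` supplies it.
    module _ {r} (r² : r ∙ r ≈ᴳ λ₀²) where

      triangle₁₂ : z₁₂ ∙ (r ∙ r) ≈ᴳ star zero ∙ star (suc zero)
      triangle₁₂ = begin
        z₁₂ ∙ (r ∙ r)                                 ≈⟨ ∙-congˡ r² ⟩
        z₁₂ ∙ ((star zero ∙ star (suc zero)) // z₁₂)  ≈⟨ assoc z₁₂ _ _ ⟨
        (z₁₂ ∙ (star zero ∙ star (suc zero))) // z₁₂  ≈⟨ xyx⁻¹≈y z₁₂ _ ⟩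
        star zero ∙ star (suc zero)                   ∎

      triangle₁ : ∀ j → z (edge (suc zero) (suc (suc j)) (s<s z<s)) ∙ (r ∙ r) ≈ᴳ
                        star zero ∙ star (suc j)
      triangle₁ zero    = triangle₁₂
      -- Trading {0, 2}, {1, j + 3} for {0, j + 3}, {1, 2} reduces the claim to the triangle on 0,
      -- 1, 2.
      triangle₁ (suc j) = ≈ᴳ-trans
        (transfer (exchange z trivial base {zero} {suc (suc zero)} {suc (suc (suc j))} {suc zero}
            (distinct₄ (λ ()) (λ ()) (λ ()) (λ ()) (λ ()) (λ ()))
            (forward refl refl) (backward refl refl) (forward refl refl) (backward refl refl))
          (≈ᴳ-trans triangle₁₂ (comm _ _)))
        (comm _ _)

      triangle : ∀ i j .(i<j : i Fin.< j) → z (edge (suc i) (suc j) (s<s i<j)) ∙ (r ∙ r) ≈ᴳ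
                 star i ∙ star j
      triangle zero    (suc j) _   = triangle₁ j
      -- Trading {0, 1}, {i + 2, j + 2} for {0, i + 2}, {1, j + 2} reduces the claim to a triangle
      -- containing 0 and 1.
      triangle (suc i) (suc j) i<j =
        transfer (exchange z trivial base {zero} {suc zero} {suc (suc i)} {suc (suc j)}
            (distinct₄ (λ ()) (λ ()) (λ ()) (λ ()) (λ ()) i≢j)
            (forward refl refl) (forward refl refl) (forward refl refl) (forward refl refl))
          (triangle₁ j)
        where
        i≢j : suc (suc i) ≢ suc (suc j)
        i≢j refl = Fin.<-irrefl refl (recompute (suc i Fin.<? suc j) i<j)

      potential : Fin (3 ℕ.+ m) → Carrier
      potential zero    = r
      potential (suc i) = star i // r

      potential-edge : ∀ e → potential (lo e) ∙ potential (hi e) ≈ᴳ z e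
      potential-edge (edge zero zero ())
      potential-edge (edge (suc i) zero ())
      potential-edge (edge zero (suc j) _) =
        ≈ᴳ-trans (≈ᴳ-sym (assoc r (star j) (r ⁻¹))) (xyx⁻¹≈y r (star j))
      potential-edge (edge (suc i) (suc j) i<j) = begin
        (star i // r) ∙ (star j // r)      ≈⟨ interchange (star i) (r ⁻¹) (star j) (r ⁻¹) ⟩
        (star i ∙ star j) ∙ (r ⁻¹ ∙ r ⁻¹)  ≈⟨ ∙-cong (triangle i j (s<s⁻¹ i<j))
                                                (≈ᴳ-sym (⁻¹-∙-comm r r)) ⟨
        (zᵢⱼ ∙ (r ∙ r)) // (r ∙ r)         ≈⟨ //-rightDividesʳ (r ∙ r) zᵢⱼ ⟩
        zᵢⱼ                                ∎
        where zᵢⱼ = z (edge (suc i) (suc j) i<j)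

-- Fibers lie in orbits

theorem4p4 : ∀ {ℓ} (n : ℕ) → 4 ≤ n → 2 ∣ n →
    (D : Pred (Setoid.Carrier (ℝ>0^ Edge n)) ℓ) → D Respects Setoid._≈_ (ℝ>0^ Edge n) →
    Γ-Invariant D → FiberInvariant (φ n) D
theorem4p4 _ () (divides 0 refl)
theorem4p4 _ (s≤s (s≤s ())) (divides 1 refl)
-- With 0 and 2 excluded, n computes to 4 + k * 2, which has the shape 3 + m required for the star
-- construction.
theorem4p4 n _ (divides (suc (suc k)) refl) D D-resp D-inv y (x , x∈D , φx≈y) {w} φw≈y =
  -- Invariance reaches `potentials · x`, which agrees with w only up to equality of cuts; `D-resp`
  -- bridges the difference.
  D-resp {potentials · x} {w} potentials·x≈w (D-inv potentials x x∈D)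
  where
  open AbelianGroup ℝ>0-abelianGroup using (∙-congʳ; setoid) renaming (_-_ to _//_)
  open AbelianGroupProperties ℝ>0-abelianGroup using (x≈y⇒x∙y⁻¹≈ε; //-rightDividesˡ)
  open import Relation.Binary.Reasoning.Setoid setoid

  z : Edge n → ℝ>0
  z e = w e // x e

  z-trivial : ∀ M → matchingProduct z M ≈ 1ℝ>0
  z-trivial M = begin
    matchingProduct z M
      ≈⟨ product-map-// ℝ>0-abelianGroup w x (filterᵇ (member M) (edges n)) ⟩
    matchingProduct w M // matchingProduct x M
      ≈⟨ x≈y⇒x∙y⁻¹≈ε {matchingProduct w M} {matchingProduct x M} φw≈φx ⟩
    1ℝ>0 ∎
    where
    φw≈φx = ≈-trans {matchingProduct w M} {y M} {matchingProduct x M} (φw≈y M)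
      (≈-sym {matchingProduct x M} {y M} (φx≈y M))

  base : Pairing n
  base = evenPairing (suc (suc k))

  λ₀ : ∃ λ r → r *⁺ r ≈ λ₀² ℝ>0-abelianGroup base z z-trivial
  λ₀ = sqrt (λ₀² ℝ>0-abelianGroup base z z-trivial)

  potentials : Fin n → ℝ>0
  potentials = potential ℝ>0-abelianGroup base z z-trivial {proj₁ λ₀} (proj₂ λ₀)

  potentials·x≈w : ∀ e → (potentials · x) e ≈ w e
  potentials·x≈w e = begin
    potentials (lo e) *⁺ potentials (hi e) *⁺ x e
      ≈⟨ ∙-congʳ {x e} {potentials (lo e) *⁺ potentials (hi e)} {z e}
           (potential-edge ℝ>0-abelianGroup base z z-trivial {proj₁ λ₀} (proj₂ λ₀) e) ⟩
    z e *⁺ x e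
      ≈⟨ //-rightDividesˡ (x e) (w e) ⟩
    w e ∎
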